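{- The maps $\Phi:\mathcal{C}\to\mathcal{D}$ and $\Psi:\mathcal{D}\to\mathcal{C}$ satisfy $\Psi\circ\Phi=\mathrm{Id}_{\mathcal{C}}$ and $\Phi\circ\Psi=\mathrm{Id}_{\mathcal{D}}$.
   Context: Let $a_1<\dots<a_m$ be totally ordered primary colors; $\chi(A)=1$ if $A$ is true, $0$ otherwise, and $\delta_{pq}=\chi(p\le q)$. Let $\mathcal{O}=\mathbb{Z}\times\{a_1,\dots,a_m\}$ (primary parts; $(k,p)$ has size $k$ and color $p$), $\mathcal{E}=\mathbb{Z}\times\{a_1,\dots,a_m\}^2$ (secondary parts; $(k,p,q)$ has size $2k+\delta_{pq}$ and color $pq$), and let $\mathcal{O}'\subset\mathcal{O}$, $\mathcal{E}'\subset\mathcal{E}$ be the subsets with first coordinate in $\mathbb{Z}_{>0}$. The upper and lower halves of $(k,p,q)\in\mathcal{E}$ are $\gamma(k,p,q)=(k+\delta_{pq},p)$ and $\mu(k,p,q)=(k,q)$ in $\mathcal{O}$. On $\mathcal{O}$: $(k,p)>_c(l,q)\iff k-l\ge\delta_{pq}$. The relation $\gg_c$ on $\mathcal{O}\cup\mathcal{E}$ is: $(k,p)\gg_c(l,q)\iff k-l\ge 1+\delta_{pq}$; $(k,p)\gg_c(l,q,r)\iff k-(2l+\delta_{qr})\ge\delta_{pq}+\delta_{qr}$; $(k,p,q)\gg_c(l,r)\iff (2k+\delta_{pq})-l\ge 1+\delta_{pq}+\delta_{qr}$; $(k,p,q)\gg_c(l,r,t)\iff (2k+\delta_{pq})-(2l+\delta_{rt})\ge\delta_{pq}+2\delta_{qr}+\delta_{rt}$.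 $\mathcal{C}$ is the set of finite sequences $\lambda_1>_c\cdots>_c\lambda_s$ in $\mathcal{O}'$; $\mathcal{D}$ is the set of finite sequences $\nu_1\gg_c\cdots\gg_c\nu_t$ in $\mathcal{O}'\cup\mathcal{E}'$. $\Lambda:\mathcal{O}\times\mathcal{E}\to\mathcal{E}\times\mathcal{O}$ is the bijection $\Lambda((k,p),(l,q,r))=((l+\delta_{qr},p,q),(k-\delta_{pq}-\delta_{qr},r))$, with inverse $\Lambda^{ -1}((l',p,q),(k',r))=((k'+\delta_{pq}+\delta_{qr},p),(l'-\delta_{qr},q,r))$. Definition of $\Phi(\lambda)$ for $\lambda=(\lambda_1,\dots,\lambda_s)\in\mathcal{C}$. Step 1: let $i_1$ be the smallest $i\in\{1,\dots,s-1\}$ with $\lambda_i\not\gg_c\lambda_{i+1}$, and recursively let $i_k$ be the smallest $i\in\{i_{k-1}+2,\dots,s-1\}$ with $\lambda_i\not\gg_c\lambda_{i+1}$, as long as one exists; replace, in place, each pair $(\lambda_{i_k},\lambda_{i_k+1})$ by the unique element of $\mathcal{E}'$ having $\lambda_{i_k}$ as upper half and $\lambda_{i_k+1}$ as lower half. Step 2: as long as the current sequence contains consecutive entries $(x,y)\in\mathcal{O}\times\mathcal{E}$ with $x\not\gg_c y$, choose such a pair and replace it by $\Lambda(x,y)$. The final sequence is $\Phi(\lambda)$. Definition of $\Psi(\nu)$ for $\nu\in\mathcal{D}$. Step 1: as long as the current sequence contains consecutive entries $(x,y)\in\mathcal{E}\times\mathcal{O}$ with $\mu(x)\not>_c y$,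 choose such a pair and replace it by $\Lambda^{ -1}(x,y)$. Step 2: replace, in place, every element of $\mathcal{E}$ in the resulting sequence by its upper half followed by its lower half. The final sequence is $\Psi(\nu)$. Both procedures terminate, their results do not depend on the choices made, and they give maps $\Phi:\mathcal{C}\to\mathcal{D}$, $\Psi:\mathcal{D}\to\mathcal{C}$. -}

module Defs where

open import Data.Bool.Base using (Bool; true; false; if_then_else_)
open import Data.Fin.Base as Fin using (Fin)
import Data.Fin.Properties as Fin
open import Data.Integer.Base using (ℤ; +_; 0ℤ; 1ℤ; _+_; _-_; -_; _*_; _≤_; _<_; _≥_)
open import Data.Integer.Properties using (_≤?_; ≤-antisym; ≰⇒>; i<j⇒i≤pred[j]; pred-suc; +-assoc; +-comm; +-inverseˡ; +-identityʳ)
open import Data.List.Base using (List; []; _∷_; [_]; concatMap; foldr)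
open import Data.List.Relation.Unary.All using (All)
open import Data.List.Relation.Unary.Linked using (Linked)
import Data.Nat.Base as ℕ
import Data.Nat.Properties as ℕ
open import Data.Nat.Induction using (<-wellFounded)
open import Data.Product using (∃; ∃!; _×_; _,_; -,_; proj₁; proj₂; map)
open import Data.Sum.Base using (_⊎_; inj₁; inj₂)
open import Function.Base using (_on_)
open import Induction.WellFounded using (module Subrelation)
open import Level using (0ℓ)
import Relation.Binary.Construct.On as On
open import Relation.Binary.Construct.Closure.ReflexiveTransitive using (Star; ε; _◅_; _◅◅_; gmap)
open import Relation.Binary.Core using (Rel)
open import Relation.Binary.Definitions using (Decidable)
open import Relation.Binary.PropositionalEquality using (_≡_; refl; sym; trans; cong; subst; module ≡-Reasoning)
open import Relation.Binary.Rewriting using (IsNormalForm; StronglyNormalizing)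
open import Relation.Nullary using (¬_; Dec; yes; no; contradiction)
open import Relation.Nullary.Decidable using (⌊_⌋)

-- The totally ordered primary colours a₁ < ⋯ < aₘ are the elements of Fin m.

variable
  m : ℕ.ℕ

δ : Fin m → Fin m → ℤ
δ p q = if ⌊ p Fin.≤? q ⌋ then 1ℤ else 0ℤ

𝒪 : ℕ.ℕ → Set
𝒪 m = ℤ × Fin m

ℰ : ℕ.ℕ → Set
ℰ m = ℤ × Fin m × Fin m

Part : ℕ.ℕ → Set
Part m = 𝒪 m ⊎ ℰ m

γ : ℰ m → 𝒪 m
γ (k , p , q) = k + δ p q , p

μ : ℰ m → 𝒪 m
μ (k , p , q) = k , q

Positive : Part m → Set
Positive (inj₁ (k , _)) = 0ℤ < k
Positive (inj₂ (k , _)) = 0ℤ < k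

infix 4 _>ᶜ_ _>ᶜ?_ _≫_ _≫?_

_>ᶜ_ : Rel (𝒪 m) 0ℓ
(k , p) >ᶜ (l , q) = k - l ≥ δ p q

_≫_ : Rel (Part m) 0ℓ
inj₁ (k , p)     ≫ inj₁ (l , q)     = k - l ≥ 1ℤ + δ p q
inj₁ (k , p)     ≫ inj₂ (l , q , r) = k - (+ 2 * l + δ q r) ≥ δ p q + δ q r
inj₂ (k , p , q) ≫ inj₁ (l , r)     = (+ 2 * k + δ p q) - l ≥ 1ℤ + δ p q + δ q r
inj₂ (k , p , q) ≫ inj₂ (l , r , t) =
  (+ 2 * k + δ p q) - (+ 2 * l + δ r t) ≥ δ p q + + 2 * δ q r + δ r t

_>ᶜ?_ : Decidable (_>ᶜ_ {m})
(k , p) >ᶜ? (l , q) = _ ≤? _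

_≫?_ : Decidable (_≫_ {m})
inj₁ (k , p)     ≫? inj₁ (l , q)     = _ ≤? _
inj₁ (k , p)     ≫? inj₂ (l , q , r) = _ ≤? _
inj₂ (k , p , q) ≫? inj₁ (l , r)     = _ ≤? _
inj₂ (k , p , q) ≫? inj₂ (l , r , t) = _ ≤? _

infix 4 _∈𝒞 _∈𝒟

_∈𝒞 : List (𝒪 m) → Set
xs ∈𝒞 = All (λ x → Positive (inj₁ x)) xs × Linked _>ᶜ_ xs

_∈𝒟 : List (Part m) → Set
xs ∈𝒟 = All Positive xs × Linked _≫_ xs

Λ : 𝒪 m × ℰ m → ℰ m × 𝒪 m
Λ ((k , p) , (l , q , r)) = (l + δ q r , p , q) , (k - δ p q - δ q r , r)

Λ⁻¹ : ℰ m × 𝒪 m → 𝒪 m × ℰ m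
Λ⁻¹ ((l , p , q) , (k , r)) = (k + δ p q + δ q r , p) , (l - δ q r , q , r)

module _ {A : Set} where

  data Step (Rule : Rel (A × A) 0ℓ) : Rel (List A) 0ℓ where
    here  : ∀ {x y x′ y′ zs} → Rule (x , y) (x′ , y′) →
            Step Rule (x ∷ y ∷ zs) (x′ ∷ y′ ∷ zs)
    there : ∀ {x ys zs} → Step Rule ys zs → Step Rule (x ∷ ys) (x ∷ zs)

  -- ys is a possible final sequence when rules are applied to xs, at
  -- arbitrarily chosen places, for as long as possible.
  Outcome : Rel (A × A) 0ℓ → Rel (List A) 0ℓ
  Outcome Rule xs ys = Star (Step Rule) xs ys × IsNormalForm (Step Rule) ys

-- When every rule turns a pair of kinds (true , false) into one of kinds
-- (false , true), all maximal runs are finite and have the same outcome.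

module Exchange
  {A : Set} (Rule : Rel (A × A) 0ℓ) (kind : A → Bool)
  (rule?  : ∀ xy → Dec (∃ (Rule xy)))
  (unique : ∀ {xy u v} → Rule xy u → Rule xy v → u ≡ v)
  (kinds  : ∀ {x y x′ y′} → Rule (x , y) (x′ , y′) →
            kind x ≡ true × kind y ≡ false × kind x′ ≡ false × kind y′ ≡ true)
  where

  _⟶_ : Rel (List A) 0ℓ
  _⟶_ = Step Rule

  Normal : List A → Set
  Normal = IsNormalForm _⟶_

  fixed : ∀ {x y u} → kind x ≡ false → ¬ Rule (x , y) u
  fixed kx r with kinds r
  ... | kx′ , _ with trans (sym kx) kx′
  ... | ()

  insert : A → List A → List A
  insert x []       = [ x ]
  insert x (y ∷ ys) with rule? (x , y)
  ... | yes ((x′ , y′) , _) = x′ ∷ insert y′ ys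
  ... | no _                = x ∷ y ∷ ys

  normalise : List A → List A
  normalise = foldr insert []

  insert-run : ∀ x ys → Star _⟶_ (x ∷ ys) (insert x ys)
  insert-run x []       = ε
  insert-run x (y ∷ ys) with rule? (x , y)
  ... | yes ((x′ , y′) , r) = here r ◅ gmap (x′ ∷_) there (insert-run y′ ys)
  ... | no _                = ε

  normalise-run : ∀ xs → Star _⟶_ xs (normalise xs)
  normalise-run []       = ε
  normalise-run (x ∷ xs) =
    gmap (x ∷_) there (normalise-run xs) ◅◅ insert-run x (normalise xs)

  tail-normal : ∀ {x xs} → Normal (x ∷ xs) → Normal xs
  tail-normal n (_ , s) = n (-, there s)

  cons-normal : ∀ {x xs} → kind x ≡ false → Normal xs → Normal (x ∷ xs)
  cons-normal kx n (_ , here r)  = fixed kx r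
  cons-normal kx n (_ , there s) = n (-, s)

  insert-normal : ∀ x {ys} → Normal ys → Normal (insert x ys)
  insert-normal x {[]}     n (_ , there (()))
  insert-normal x {y ∷ ys} n with rule? (x , y)
  ... | yes ((x′ , y′) , r) =
    cons-normal (proj₁ (proj₂ (proj₂ (kinds r)))) (insert-normal y′ (tail-normal n))
  ... | no ¬r = λ where
    (_ , here r)  → ¬r (-, r)
    (_ , there s) → n (-, s)

  normalise-normal : ∀ xs → Normal (normalise xs)
  normalise-normal []       (_ , ())
  normalise-normal (x ∷ xs) = insert-normal x (normalise-normal xs)

  insert-fixed : ∀ {x} → kind x ≡ false → ∀ ys → insert x ys ≡ x ∷ ys
  insert-fixed kx []       = refl
  insert-fixed {x} kx (y ∷ ys) with rule? (x , y)
  ... | yes (_ , r) = contradiction r (fixed kx)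
  ... | no _        = refl

  insert-rule : ∀ {x y x′ y′} → Rule (x , y) (x′ , y′) →
                ∀ ys → insert x (y ∷ ys) ≡ x′ ∷ insert y′ ys
  insert-rule {x} {y} r ys with rule? (x , y)
  ... | no ¬r = contradiction (-, r) ¬r
  ... | yes (_ , r′) with unique r r′
  ... | refl = refl

  normalise-step : ∀ {xs ys} → xs ⟶ ys → normalise xs ≡ normalise ys
  normalise-step {x ∷ y ∷ zs} {x′ ∷ y′ ∷ _} (here r) with kinds r
  ... | _ , ky , kx′ , _ = begin
    insert x (insert y ws)    ≡⟨ cong (insert x) (insert-fixed ky ws) ⟩
    insert x (y ∷ ws)         ≡⟨ insert-rule r ws ⟩
    x′ ∷ insert y′ ws         ≡⟨ insert-fixed kx′ (insert y′ ws) ⟨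
    insert x′ (insert y′ ws)  ∎
    where
    open ≡-Reasoning
    ws = normalise zs
  normalise-step (there s) = cong (insert _) (normalise-step s)

  insert-id : ∀ x ys → Normal (x ∷ ys) → insert x ys ≡ x ∷ ys
  insert-id x []       n = refl
  insert-id x (y ∷ ys) n with rule? (x , y)
  ... | yes (_ , r) = contradiction (-, here r) n
  ... | no _        = refl

  normalise-id : ∀ xs → Normal xs → normalise xs ≡ xs
  normalise-id []       n = refl
  normalise-id (x ∷ xs) n =
    trans (cong (insert x) (normalise-id xs (tail-normal n))) (insert-id x xs n)

  normalise-outcome : ∀ {xs ys} → Outcome Rule xs ys → normalise xs ≡ ys
  normalise-outcome (ε , n)      = normalise-id _ n
  normalise-outcome (s ◅ ss , n) = trans (normalise-step s) (normalise-outcome (ss , n))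

  outcome : ∀ xs → ∃! _≡_ (Outcome Rule xs)
  outcome xs =
    normalise xs , (normalise-run xs , normalise-normal xs) , normalise-outcome

  falses : List A → ℕ.ℕ
  falses []       = 0
  falses (x ∷ xs) = (if kind x then 0 else 1) ℕ.+ falses xs

  inversions : List A → ℕ.ℕ
  inversions []       = 0
  inversions (x ∷ xs) = (if kind x then falses xs else 0) ℕ.+ inversions xs

  falses-step : ∀ {xs ys} → xs ⟶ ys → falses xs ≡ falses ys
  falses-step (here r) with kinds r
  ... | kx , ky , kx′ , ky′ rewrite kx | ky | kx′ | ky′ = refl
  falses-step (there {x = x} s) =
    cong ((if kind x then 0 else 1) ℕ.+_) (falses-step s)

  inversions-step : ∀ {xs ys} → xs ⟶ ys → inversions ys ℕ.< inversions xs
  inversions-step (here r) with kinds r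
  ... | kx , ky , kx′ , ky′ rewrite kx | ky | kx′ | ky′ = ℕ.≤-refl
  inversions-step (there {x = x} s) rewrite falses-step s =
    ℕ.+-monoʳ-< (if kind x then _ else 0) (inversions-step s)

  terminates : StronglyNormalizing _⟶_
  terminates = Subrelation.wellFounded inversions-step
    (On.wellFounded inversions <-wellFounded)

-- The element of ℰ with upper half x and lower half y, if there is one.
merge : 𝒪 m → 𝒪 m → ℰ m
merge (k , p) (l , q) = l , p , q

merge-unique : ∀ (x y : 𝒪 m) z → γ z ≡ x → μ z ≡ y → z ≡ merge x y
merge-unique _ _ (k , p , q) refl refl = refl

merge-halves : ∀ (x y : 𝒪 m) → x >ᶜ y → ¬ inj₁ x ≫ inj₁ y →
               γ (merge x y) ≡ x × μ (merge x y) ≡ y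
merge-halves (k , p) (l , q) x>y x≫̸y = cong (_, p) eq , refl
  where
  open ≡-Reasoning
  k-l≡δ : k - l ≡ δ p q
  k-l≡δ = ≤-antisym
    (subst (k - l ≤_) (pred-suc (δ p q)) (i<j⇒i≤pred[j] (≰⇒> x≫̸y))) x>y
  eq : l + δ p q ≡ k
  eq = begin
    l + δ p q      ≡⟨ cong (λ i → l + i) k-l≡δ ⟨
    l + (k - l)    ≡⟨ +-comm l (k - l) ⟩
    (k - l) + l    ≡⟨ +-assoc k (- l) l ⟩
    k + (- l + l)  ≡⟨ cong (λ i → k + i) (+-inverseˡ l) ⟩
    k + 0ℤ         ≡⟨ +-identityʳ k ⟩
    k              ∎

-- Scanning from the left and skipping both entries of a merged pair selects
-- exactly the indices i₁ < i₂ < ⋯ of the first step.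
Φ₁ : List (𝒪 m) → List (Part m)
Φ₁ []           = []
Φ₁ (x ∷ [])     = [ inj₁ x ]
Φ₁ (x ∷ y ∷ zs) = if ⌊ inj₁ x ≫? inj₁ y ⌋
  then inj₁ x ∷ Φ₁ (y ∷ zs)
  else inj₂ (merge x y) ∷ Φ₁ zs

data Φ-Rule {m} : Rel (Part m × Part m) 0ℓ where
  cross : ∀ {x y} → ¬ inj₁ x ≫ inj₂ y →
          Φ-Rule (inj₁ x , inj₂ y) (map inj₂ inj₁ (Λ (x , y)))

isPrimary isSecondary : Part m → Bool
isPrimary (inj₁ _) = true
isPrimary (inj₂ _) = false
isSecondary (inj₁ _) = false
isSecondary (inj₂ _) = true

Φ-rule? : ∀ (xy : Part m × Part m) → Dec (∃ (Φ-Rule xy))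
Φ-rule? (inj₁ x , inj₂ y) with inj₁ x ≫? inj₂ y
... | yes x≫y = no λ where (_ , cross x≫̸y) → x≫̸y x≫y
... | no  x≫̸y = yes (-, cross x≫̸y)
Φ-rule? (inj₁ _ , inj₁ _) = no λ ()
Φ-rule? (inj₂ _ , _)      = no λ ()

Φ-unique : ∀ {xy u v : Part m × Part m} → Φ-Rule xy u → Φ-Rule xy v → u ≡ v
Φ-unique (cross _) (cross _) = refl

Φ-kinds : ∀ {x y x′ y′ : Part m} → Φ-Rule (x , y) (x′ , y′) →
          isPrimary x ≡ true × isPrimary y ≡ false ×
          isPrimary x′ ≡ false × isPrimary y′ ≡ true
Φ-kinds (cross _) = refl , refl , refl , refl

module Φ₂ {m} = Exchange (Φ-Rule {m}) isPrimary Φ-rule? Φ-unique Φ-kinds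

Φ : List (𝒪 m) → List (Part m)
Φ xs = proj₁ (Φ₂.outcome (Φ₁ xs))

data Ψ-Rule {m} : Rel (Part m × Part m) 0ℓ where
  cross : ∀ {x y} → ¬ μ x >ᶜ y →
          Ψ-Rule (inj₂ x , inj₁ y) (map inj₁ inj₂ (Λ⁻¹ (x , y)))

Ψ-rule? : ∀ (xy : Part m × Part m) → Dec (∃ (Ψ-Rule xy))
Ψ-rule? (inj₂ x , inj₁ y) with μ x >ᶜ? y
... | yes x>y = no λ where (_ , cross x≯y) → x≯y x>y
... | no  x≯y = yes (-, cross x≯y)
Ψ-rule? (inj₂ _ , inj₂ _) = no λ ()
Ψ-rule? (inj₁ _ , _)      = no λ ()

Ψ-unique : ∀ {xy u v : Part m × Part m} → Ψ-Rule xy u → Ψ-Rule xy v → u ≡ v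
Ψ-unique (cross _) (cross _) = refl

Ψ-kinds : ∀ {x y x′ y′ : Part m} → Ψ-Rule (x , y) (x′ , y′) →
          isSecondary x ≡ true × isSecondary y ≡ false ×
          isSecondary x′ ≡ false × isSecondary y′ ≡ true
Ψ-kinds (cross _) = refl , refl , refl , refl

module Ψ₁ {m} = Exchange (Ψ-Rule {m}) isSecondary Ψ-rule? Ψ-unique Ψ-kinds

halves : Part m → List (𝒪 m)
halves (inj₁ x) = [ x ]
halves (inj₂ z) = γ z ∷ μ z ∷ []

Ψ₂ : List (Part m) → List (𝒪 m)
Ψ₂ = concatMap halves

Ψ : List (Part m) → List (𝒪 m)
Ψ xs = Ψ₂ (proj₁ (Ψ₁.outcome xs))

{-# OPTIONS --safe #-}
module Submission where

-- Let ℳ be the set of sequences of positive parts linked by ⊳, where x ⊳ y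
-- says that the last primary part of x (x itself, or its lower half) stands in
-- the required relation to the first primary part of y (y itself, or its upper
-- half): ≫ if x is primary, >ᶜ if x is secondary.  Merging non-≫ pairs and
-- splitting secondary parts into halves are inverse bijections between 𝒞 and ℳ,
-- so what remains is to see that the exchanges Λ and Λ⁻¹ give inverse
-- bijections between ℳ and 𝒟.
--
-- Both rules act on a common set of sequences, containing ℳ and 𝒟.  Any part z
-- of a sequence can be moved to the left past parts of the other kind, by Λ if
-- it is secondary and by Λ⁻¹ if it is primary.  The front values of a sequence
-- are its head and its first part of the other kind, the latter after having
-- been moved to the front.  A sequence of positive parts is balanced if each of
-- its parts is in the relation ⊵ to the front values of the sequence that
-- follows it; here ⊵ is the weaker of ⊳ and ≫, in each of the four combinations
-- of kinds.  Since a step of Φ or Ψ creates no new front value, few inequalities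
-- have to be verified in order to see the following:
--
--   * the rules of Φ and Ψ preserve balanced sequences, and on these each
--     application of one rule is undone by the other rule;
--   * a balanced sequence to which the rule of Ψ (of Φ) does not apply is in ℳ
--     (in 𝒟);
--   * members of ℳ and of 𝒟 are balanced.  The relations ⊳ and ≫ satisfy a
--     form of transitivity in which the third part is moved past the second
--     (Composable), so they propagate from neighbours to front values.
--
-- A maximal run of the rule of Φ from a member of ℳ therefore ends in 𝒟 and,
-- read backwards, is a run of the rule of Ψ whose end admits no further step.  By
-- uniqueness of outcomes, the first step of Ψ recovers the given member of ℳ.
-- The same holds with the roles exchanged.

open import Defs
open import Data.Fin.Base using (Fin)
import Data.Fin.Properties as Fin
open import Data.Integer.Base using (ℤ; +_; +≤+; 0ℤ; 1ℤ; -1ℤ; _+_; _-_; _*_; _≤_; _<_; suc)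
open import Data.Integer.Properties
  using (_≤?_; ≤-refl; ≰⇒>; +-mono-≤; +-mono-<-≤; i≤j⇒0≤j-i; 0≤i-j⇒j≤i;
         i<j⇒suc[i]≤j; suc[i]≤j⇒i<j)
open import Data.Integer.Tactic.RingSolver using (solve-∀)
open import Data.List.Base using (List; []; _∷_; head)
open import Data.List.Relation.Unary.All using (All; []; _∷_)
open import Data.List.Relation.Unary.Linked using (Linked; []; [-]; _∷_; _∷′_)
open import Data.Maybe.Base using (just)
open import Data.Maybe.Relation.Binary.Connected using (Connected; just)
open import Data.Nat.Base using (ℕ; z≤n)
open import Data.Product using (_×_; _,_; -,_; proj₁; proj₂; map)
open import Data.Sum.Base using (inj₁; inj₂)
open import Level using (0ℓ)
open import Relation.Binary.Construct.Closure.ReflexiveTransitive using (Star; ε; _◅_; _◅◅_)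
open import Relation.Binary.Core using (Rel)
open import Relation.Binary.PropositionalEquality using (_≡_; refl; sym; trans; cong; cong₂; subst)
open import Relation.Binary.Rewriting using (IsNormalForm)
open import Relation.Nullary using (¬_; yes; no; contradiction)
open import Relation.Unary using (_⊆_)

-- Linear inequalities over ℤ

-- Write a - b for the slack of b ≤ a.  An inequality follows from others if its
-- slack equals the sum of theirs, which is an identity between polynomials.

by : ∀ {a b c d : ℤ} → b ≤ a → a - b ≡ c - d → d ≤ c
by b≤a eq = 0≤i-j⇒j≤i (subst (0ℤ ≤_) eq (i≤j⇒0≤j-i b≤a))

infixr 5 _⊕_
_⊕_ : ∀ {a b c d : ℤ} → b ≤ a → d ≤ c → b + d ≤ a + c
_⊕_ = +-mono-≤

absurd : ∀ {a b : ℤ} → b ≤ a → ¬ a - b ≡ -1ℤ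
absurd b≤a eq with subst (0ℤ ≤_) eq (i≤j⇒0≤j-i b≤a)
... | ()

≰⇒suc≤ : ∀ {i j : ℤ} → ¬ i ≤ j → suc j ≤ i
≰⇒suc≤ i≰j = i<j⇒suc[i]≤j (≰⇒> i≰j)

-- The integer c - d is nonnegative as soon as 2 (c - d) + 1 is.
by-half : ∀ {a b c d : ℤ} → b ≤ a → a - b ≡ + 2 * (c - d) + 1ℤ → d ≤ c
by-half {a} {b} {c} {d} b≤a eq with d ≤? c
... | yes d≤c = d≤c
... | no  d≰c = contradiction
  (trans (slack a b c d) (trans (cong (_+ (+ 2 * (d - c) - + 2)) eq) (cancel c d)))
  (absurd (b≤a ⊕ c<d ⊕ c<d))
  where
  c<d : suc c ≤ d
  c<d = ≰⇒suc≤ d≰c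
  slack : ∀ a b c d → (a + (d + d)) - (b + (1ℤ + c + (1ℤ + c))) ≡
                      (a - b) + (+ 2 * (d - c) - + 2)
  slack = solve-∀
  cancel : ∀ c d → + 2 * (c - d) + 1ℤ + (+ 2 * (d - c) - + 2) ≡ -1ℤ
  cancel = solve-∀

0≤1 : 0ℤ ≤ 1ℤ
0≤1 = +≤+ z≤n

0≤δ : ∀ (p q : Fin m) → 0ℤ ≤ δ p q
0≤δ p q with p Fin.≤? q
... | yes _ = 0≤1
... | no  _ = ≤-refl

δ≤1 : ∀ (p q : Fin m) → δ p q ≤ 1ℤ
δ≤1 p q with p Fin.≤? q
... | yes _ = ≤-refl
... | no  _ = 0≤1

positive⇒1≤ : ∀ {k : ℤ} → 0ℤ < k → 1ℤ ≤ k
positive⇒1≤ = i<j⇒suc[i]≤j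

1≤⇒positive : ∀ {k : ℤ} → 1ℤ ≤ k → 0ℤ < k
1≤⇒positive = suc[i]≤j⇒i<j

positive+δ : ∀ {k} (p q : Fin m) → 0ℤ < k → 0ℤ < k + δ p q
positive+δ p q 0<k = +-mono-<-≤ 0<k (0≤δ p q)

-- Exchanged parts and the relations ⊳ and ⊵

-- The components of Λ and Λ⁻¹.
Λℰ : 𝒪 m → ℰ m → ℰ m
Λℰ x y = proj₁ (Λ (x , y))

Λ𝒪 : 𝒪 m → ℰ m → 𝒪 m
Λ𝒪 x y = proj₂ (Λ (x , y))

Λ⁻¹𝒪 : ℰ m → 𝒪 m → 𝒪 m
Λ⁻¹𝒪 x y = proj₁ (Λ⁻¹ (x , y))

Λ⁻¹ℰ : ℰ m → 𝒪 m → ℰ m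
Λ⁻¹ℰ x y = proj₂ (Λ⁻¹ (x , y))

Λ⁻¹∘Λ : ∀ (x : 𝒪 m) y → Λ⁻¹ (Λ (x , y)) ≡ (x , y)
Λ⁻¹∘Λ (k , p) (l , q , r) =
  cong₂ (λ k′ l′ → (k′ , p) , (l′ , q , r))
    (restore k (δ p q) (δ q r)) (restore′ l (δ q r))
  where
  restore : ∀ k a b → k - a - b + a + b ≡ k
  restore = solve-∀
  restore′ : ∀ l b → l + b - b ≡ l
  restore′ = solve-∀

Λ∘Λ⁻¹ : ∀ (x : ℰ m) y → Λ (Λ⁻¹ (x , y)) ≡ (x , y)
Λ∘Λ⁻¹ (l , p , q) (k , r) =
  cong₂ (λ l′ k′ → (l′ , p , q) , (k′ , r))
    (restore′ l (δ q r)) (restore k (δ p q) (δ q r))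
  where
  restore : ∀ k a b → k + a + b - a - b ≡ k
  restore = solve-∀
  restore′ : ∀ l b → l - b + b ≡ l
  restore′ = solve-∀

-- The first primary part of a part: itself, or its upper half.
upper : Part m → 𝒪 m
upper (inj₁ x) = x
upper (inj₂ z) = γ z

infix 4 _⊳_ _⊵_ _∈ℳ

-- The relation between neighbours after the first step of Φ.
_⊳_ : Rel (Part m) 0ℓ
inj₁ x ⊳ y = inj₁ x ≫ inj₁ (upper y)
inj₂ x ⊳ y = μ x >ᶜ upper y

_∈ℳ : List (Part m) → Set
xs ∈ℳ = All Positive xs × Linked _⊳_ xs

-- For positive parts, ⊵ is implied by ⊳ and by ≫.
_⊵_ : Rel (Part m) 0ℓ
inj₁ x ⊵ y      = inj₁ x ⊳ y
inj₂ x ⊵ inj₁ y = inj₂ x ≫ inj₁ y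
inj₂ x ⊵ inj₂ y = inj₂ x ⊳ inj₂ y

⊳⇒≫-secondary : ∀ (x y : ℰ m) → inj₂ x ⊳ inj₂ y → inj₂ x ≫ inj₂ y
⊳⇒≫-secondary (k , p , q) (l , r , s) x⊳y =
  by (x⊳y ⊕ x⊳y) (slack k l (δ p q) (δ q r) (δ r s))
  where
  slack : ∀ k l a b c → (k - (l + c) + (k - (l + c))) - (b + b) ≡
    (+ 2 * k + a) - (+ 2 * l + c) - (a + + 2 * b + c)
  slack = solve-∀

≫⇒⊳-secondary : ∀ (x y : ℰ m) → inj₂ x ≫ inj₂ y → inj₂ x ⊳ inj₂ y
≫⇒⊳-secondary (k , p , q) (l , r , s) x≫y =
  by-half (x≫y ⊕ 0≤1) (slack k l (δ p q) (δ q r) (δ r s))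
  where
  slack : ∀ k l a b c →
    ((+ 2 * k + a) - (+ 2 * l + c) + 1ℤ) - (a + + 2 * b + c + 0ℤ) ≡
    + 2 * (k - (l + c) - b) + 1ℤ
  slack = solve-∀

⊳⇒⊵ : ∀ (x y : Part m) → Positive x → x ⊳ y → x ⊵ y
⊳⇒⊵ (inj₁ x) y _ x⊳y = x⊳y
⊳⇒⊵ (inj₂ x) (inj₂ y) _ x⊳y = x⊳y
⊳⇒⊵ (inj₂ (k , p , q)) (inj₁ (l , r)) 0<k x⊳y =
  by (x⊳y ⊕ positive⇒1≤ 0<k) (slack k l (δ p q) (δ q r))
  where
  slack : ∀ k l a b → (k - l + k) - (b + 1ℤ) ≡ (+ 2 * k + a) - l - (1ℤ + a + b)
  slack = solve-∀

≫⇒⊵ : ∀ (x y : Part m) → Positive y → x ≫ y → x ⊵ y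
≫⇒⊵ (inj₁ x) (inj₁ y) _ x≫y = x≫y
≫⇒⊵ (inj₂ x) (inj₁ y) _ x≫y = x≫y
≫⇒⊵ (inj₂ x) (inj₂ y) _ x≫y = ≫⇒⊳-secondary x y x≫y
≫⇒⊵ (inj₁ (k , p)) (inj₂ (l , q , r)) 0<l x≫y =
  by (x≫y ⊕ positive⇒1≤ 0<l ⊕ 0≤δ q r) (slack k l (δ p q) (δ q r))
  where
  slack : ∀ k l a b → (k - (+ 2 * l + b) + (l + b)) - (a + b + (1ℤ + 0ℤ)) ≡
    k - (l + b) - (1ℤ + a)
  slack = solve-∀

-- Front values

-- Pulled y z z′: moving z to the left past y, of the other kind, turns it into z′.
data Pulled {m} : Part m → Part m → Part m → Set where
  over𝒪 : ∀ {y z} → Pulled (inj₁ y) (inj₂ z) (inj₂ (Λℰ y z))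
  overℰ : ∀ {y z} → Pulled (inj₂ y) (inj₁ z) (inj₁ (Λ⁻¹𝒪 y z))

-- The front values of a sequence: its head, and its first part of the other
-- kind after being moved to the front.
data Front {m} : List (Part m) → Part m → Set where
  here  : ∀ {x xs} → Front (x ∷ xs) x
  later : ∀ {x xs z z′} → Front xs z → Pulled x z z′ → Front (x ∷ xs) z′

-- Each part is in relation R to all front values of the sequence following it.
data Dominating {m} (R : Rel (Part m) 0ℓ) : List (Part m) → Set where
  []  : Dominating R []
  _∷_ : ∀ {x xs} → Front xs ⊆ R x → Dominating R xs → Dominating R (x ∷ xs)

-- The common invariant of both rules.
Balanced : List (Part m) → Set
Balanced xs = All Positive xs × Dominating _⊵_ xs

dominating⇒linked : ∀ {R : Rel (Part m) 0ℓ} {xs} → Dominating R xs → Linked R xs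
dominating⇒linked []           = []
dominating⇒linked (_ ∷ [])     = [-]
dominating⇒linked (f ∷ g ∷ ds) = f here ∷ dominating⇒linked (g ∷ ds)

front-positive : ∀ {xs : List (Part m)} {z} → All Positive xs → Front xs z → Positive z
front-positive (0<x ∷ _) here = 0<x
front-positive (_ ∷ ps) (later f over𝒪) = positive+δ _ _ (front-positive ps f)
front-positive (_ ∷ ps) (later f overℰ) =
  positive+δ _ _ (positive+δ _ _ (front-positive ps f))

-- Transitivity, with the third part moved past the second.
Composable : Rel (Part m) 0ℓ → Set
Composable R = ∀ x {y z z′} → Pulled y z z′ → R x y → R y z → R x z′

linked⇒dominating : ∀ {R : Rel (Part m) 0ℓ} {xs} → Composable R →
                    Linked R xs → Dominating R xs
linked⇒dominating R-comp []  = []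
linked⇒dominating R-comp [-] = (λ ()) ∷ []
linked⇒dominating {R = R} R-comp (_∷_ {x} {y} {ys} xRy ys-linked)
  with linked⇒dominating R-comp ys-linked
... | f ∷ ds = x-dominates ∷ f ∷ ds
  where
  x-dominates : Front (y ∷ ys) ⊆ R x
  x-dominates here            = xRy
  x-dominates (later z∈ pull) = R-comp x pull xRy (f z∈)

⊳-composable : Composable (_⊳_ {m})
⊳-composable (inj₁ (k , o)) (over𝒪 {j , p} {l , q , r}) x⊳y y⊳z =
  by (x⊳y ⊕ y⊳z ⊕ 0≤1) (slack k j l (δ o p) (δ p q) (δ q r))
  where
  slack : ∀ k j l a b c → ((k - j) + ((j - (l + c)) + 1ℤ)) - ((1ℤ + a) + (1ℤ + b + 0ℤ)) ≡
    k - (l + c + b) - (1ℤ + a)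
  slack = solve-∀
⊳-composable (inj₂ (k , _ , o)) (over𝒪 {j , p} {l , q , r}) x⊳y y⊳z =
  by (x⊳y ⊕ y⊳z ⊕ 0≤1) (slack k j l (δ o p) (δ p q) (δ q r))
  where
  slack : ∀ k j l a b c → ((k - j) + ((j - (l + c)) + 1ℤ)) - (a + (1ℤ + b + 0ℤ)) ≡
    k - (l + c + b) - a
  slack = solve-∀
⊳-composable (inj₁ (k , o)) (overℰ {l , p , q} {j , r}) x⊳y y⊳z =
  by (x⊳y ⊕ y⊳z) (slack k j l (δ o p) (δ p q) (δ q r))
  where
  slack : ∀ k j l a b c → ((k - (l + b)) + (l - j)) - ((1ℤ + a) + c) ≡
    k - (j + b + c) - (1ℤ + a)
  slack = solve-∀
⊳-composable (inj₂ (k , _ , o)) (overℰ {l , p , q} {j , r}) x⊳y y⊳z =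
  by (x⊳y ⊕ y⊳z) (slack k j l (δ o p) (δ p q) (δ q r))
  where
  slack : ∀ k j l a b c → ((k - (l + b)) + (l - j)) - (a + c) ≡
    k - (j + b + c) - a
  slack = solve-∀

-- Unlike for ⊳, the sizes of secondary parts count twice here, and the bounds on
-- δ are needed.
≫-composable : Composable (_≫_ {m})
≫-composable (inj₁ (k , o)) (over𝒪 {j , p} {l , q , r}) x≫y y≫z =
  by (x≫y ⊕ y≫z ⊕ δ≤1 p q) (slack k j l (δ o p) (δ p q) (δ q r))
  where
  slack : ∀ k j l a b c →
    ((k - j) + ((j - (+ 2 * l + c)) + 1ℤ)) - ((1ℤ + a) + (b + c + b)) ≡
    k - (+ 2 * (l + c) + b) - (a + b)
  slack = solve-∀
≫-composable (inj₁ (k , o)) (overℰ {l , p , q} {j , r}) x≫y y≫z =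
  by (x≫y ⊕ y≫z ⊕ 0≤δ p q) (slack k j l (δ o p) (δ p q) (δ q r))
  where
  slack : ∀ k j l a b c →
    ((k - (+ 2 * l + b)) + (((+ 2 * l + b) - j) + b)) - ((a + b) + (1ℤ + b + c + 0ℤ)) ≡
    k - (j + b + c) - (1ℤ + a)
  slack = solve-∀
-- The two hypotheses only give 2 u + 1 ≥ 0 for the slack u of ⊳, whence u ≥ 0.
≫-composable (inj₂ (k , n , o)) (over𝒪 {j , p} {l , q , r}) x≫y y≫z =
  ⊳⇒≫-secondary (k , n , o) (Λℰ (j , p) (l , q , r))
    (by-half (x≫y ⊕ y≫z ⊕ δ≤1 o p ⊕ δ≤1 p q)
      (slack k j l (δ n o) (δ o p) (δ p q) (δ q r)))
  where
  slack : ∀ k j l d a b c →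
    (((+ 2 * k + d) - j) + ((j - (+ 2 * l + c)) + (1ℤ + 1ℤ))) -
      ((1ℤ + d + a) + (b + c + (a + b))) ≡
    + 2 * (k - (l + c + b) - a) + 1ℤ
  slack = solve-∀
≫-composable (inj₂ (k , n , o)) (overℰ {l , p , q} {j , r}) x≫y y≫z =
  by (x≫y ⊕ y≫z ⊕ 0≤δ o p ⊕ 0≤δ p q) (slack k j l (δ n o) (δ o p) (δ p q) (δ q r))
  where
  slack : ∀ k j l d a b c →
    (((+ 2 * k + d) - (+ 2 * l + b)) + (((+ 2 * l + b) - j) + (a + b))) -
      ((d + + 2 * a + b) + (1ℤ + b + c + (0ℤ + 0ℤ))) ≡
    (+ 2 * k + d) - (j + b + c) - (1ℤ + d + a)
  slack = solve-∀

ℳ⇒balanced : ∀ {xs : List (Part m)} → xs ∈ℳ → Balanced xs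
ℳ⇒balanced (ps , linked) = ps , weaken ps (linked⇒dominating ⊳-composable linked)
  where
  weaken : ∀ {xs} → All Positive xs → Dominating _⊳_ xs → Dominating _⊵_ xs
  weaken []         []       = []
  weaken (0<x ∷ ps) (f ∷ ds) = (λ z∈ → ⊳⇒⊵ _ _ 0<x (f z∈)) ∷ weaken ps ds

𝒟⇒balanced : ∀ {xs : List (Part m)} → xs ∈𝒟 → Balanced xs
𝒟⇒balanced (ps , linked) = ps , weaken ps (linked⇒dominating ≫-composable linked)
  where
  weaken : ∀ {xs} → All Positive xs → Dominating _≫_ xs → Dominating _⊵_ xs
  weaken []       []       = []
  weaken (_ ∷ ps) (f ∷ ds) =
    (λ z∈ → ≫⇒⊵ _ _ (front-positive ps z∈) (f z∈)) ∷ weaken ps ds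

-- Single exchanges

-- In this part x y is the exchanged pair, and z stands for a front value of the
-- sequence that follows it.

Λ-≫ : ∀ (x : 𝒪 m) (y : ℰ m) →
  ¬ inj₁ x ≫ inj₂ y → inj₂ (Λℰ x y) ≫ inj₁ (Λ𝒪 x y)
Λ-≫ (k , p) (l , q , r) x≫̸y =
  by (≰⇒suc≤ x≫̸y) (slack k l (δ p q) (δ q r))
  where
  slack : ∀ k l a b → (a + b) - (1ℤ + (k - (+ 2 * l + b))) ≡
    (+ 2 * (l + b) + a) - (k - a - b) - (1ℤ + a + b)
  slack = solve-∀

Λ-≯ : ∀ (x : 𝒪 m) (y : ℰ m) →
  inj₁ x ⊳ inj₂ y → ¬ μ (Λℰ x y) >ᶜ Λ𝒪 x y
Λ-≯ (k , p) (l , q , r) x⊳y x′>y′ =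
  absurd (x⊳y ⊕ x′>y′) (slack k l (δ p q) (δ q r))
  where
  slack : ∀ k l a b →
    ((k - (l + b)) + ((l + b) - (k - a - b))) - ((1ℤ + a) + b) ≡ -1ℤ
  slack = solve-∀

Λ-positive : ∀ (x : 𝒪 m) (y : ℰ m) →
  Positive (inj₂ y) → inj₁ x ⊳ inj₂ y →
  Positive (inj₂ (Λℰ x y)) × Positive (inj₁ (Λ𝒪 x y))
Λ-positive (k , p) (l , q , r) 0<y x⊳y =
  positive+δ q r 0<y ,
  1≤⇒positive (by (x⊳y ⊕ positive⇒1≤ 0<y ⊕ 0≤1) (slack k l (δ p q) (δ q r)))
  where
  slack : ∀ k l a b → ((k - (l + b)) + (l + 1ℤ)) - ((1ℤ + a) + (1ℤ + 0ℤ)) ≡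
    (k - a - b) - 1ℤ
  slack = solve-∀

Λℰ-⊵ : ∀ (x : 𝒪 m) (y : ℰ m) z →
  inj₂ y ⊵ inj₂ z → inj₂ (Λℰ x y) ⊵ inj₂ (Λℰ (Λ𝒪 x y) z)
Λℰ-⊵ (k , p) (l , q , r) (n , s , t) y⊵z =
  by y⊵z (slack l n (δ q r) (δ r s) (δ s t))
  where
  slack : ∀ l n b c d → (l - (n + d)) - c ≡ (l + b) - ((n + d) + c) - b
  slack = solve-∀

Λ𝒪-⊵-primary : ∀ (x : 𝒪 m) (y : ℰ m) z →
  inj₁ x ⊵ inj₁ (Λ⁻¹𝒪 y z) → inj₁ (Λ𝒪 x y) ⊵ inj₁ z
Λ𝒪-⊵-primary (k , p) (l , q , r) (n , s) x⊵z′ =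
  by x⊵z′ (slack k n (δ p q) (δ q r) (δ r s))
  where
  slack : ∀ k n a b c → (k - (n + b + c)) - (1ℤ + a) ≡ (k - a - b) - n - (1ℤ + c)
  slack = solve-∀

Λ𝒪-⊵-secondary : ∀ (x : 𝒪 m) (y : ℰ m) z →
  inj₁ x ⊵ inj₂ y → inj₂ y ⊵ inj₂ z → inj₁ (Λ𝒪 x y) ⊵ inj₂ z
Λ𝒪-⊵-secondary (k , p) (l , q , r) (n , s , t) x⊵y y⊵z =
  by (x⊵y ⊕ y⊵z) (slack k l n (δ p q) (δ q r) (δ r s) (δ s t))
  where
  slack : ∀ k l n a b c d → ((k - (l + b)) + (l - (n + d))) - ((1ℤ + a) + c) ≡
    (k - a - b) - (n + d) - (1ℤ + c)
  slack = solve-∀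

Λ⁻¹-⊳ : ∀ (x : ℰ m) (y : 𝒪 m) →
  ¬ μ x >ᶜ y → inj₁ (Λ⁻¹𝒪 x y) ⊳ inj₂ (Λ⁻¹ℰ x y)
Λ⁻¹-⊳ (k , p , q) (l , r) x≯y =
  by (≰⇒suc≤ x≯y) (slack k l (δ p q) (δ q r))
  where
  slack : ∀ k l a b → b - (1ℤ + (k - l)) ≡ (l + a + b) - ((k - b) + b) - (1ℤ + a)
  slack = solve-∀

Λ⁻¹-≫̸ : ∀ (x : ℰ m) (y : 𝒪 m) →
  inj₂ x ≫ inj₁ y → ¬ inj₁ (Λ⁻¹𝒪 x y) ≫ inj₂ (Λ⁻¹ℰ x y)
Λ⁻¹-≫̸ (k , p , q) (l , r) x≫y x′≫y′ =
  absurd (x≫y ⊕ x′≫y′) (slack k l (δ p q) (δ q r))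
  where
  slack : ∀ k l a b →
    (((+ 2 * k + a) - l) + ((l + a + b) - (+ 2 * (k - b) + b))) -
      ((1ℤ + a + b) + (a + b)) ≡ -1ℤ
  slack = solve-∀

Λ⁻¹-positive : ∀ (x : ℰ m) (y : 𝒪 m) →
  Positive (inj₁ y) → inj₂ x ≫ inj₁ y →
  Positive (inj₁ (Λ⁻¹𝒪 x y)) × Positive (inj₂ (Λ⁻¹ℰ x y))
Λ⁻¹-positive (k , p , q) (l , r) 0<y x≫y =
  positive+δ q r (positive+δ p q 0<y) ,
  1≤⇒positive (by-half (x≫y ⊕ positive⇒1≤ 0<y ⊕ δ≤1 q r) (slack k l (δ p q) (δ q r)))
  where
  slack : ∀ k l a b →
    (((+ 2 * k + a) - l) + (l + 1ℤ)) - ((1ℤ + a + b) + (1ℤ + b)) ≡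
    + 2 * ((k - b) - 1ℤ) + 1ℤ
  slack = solve-∀

Λ⁻¹𝒪-⊵ : ∀ (x : ℰ m) (y : 𝒪 m) z →
  inj₁ y ⊵ inj₁ z → inj₁ (Λ⁻¹𝒪 x y) ⊵ inj₁ (Λ⁻¹𝒪 (Λ⁻¹ℰ x y) z)
Λ⁻¹𝒪-⊵ (k , p , q) (l , r) (n , s) y⊵z =
  by y⊵z (slack l n (δ p q) (δ q r) (δ r s))
  where
  slack : ∀ l n a b c → (l - n) - (1ℤ + c) ≡ (l + a + b) - (n + b + c) - (1ℤ + a)
  slack = solve-∀

Λ⁻¹ℰ-⊵-secondary : ∀ (x : ℰ m) (y : 𝒪 m) z →
  inj₂ x ⊵ inj₂ (Λℰ y z) → inj₂ (Λ⁻¹ℰ x y) ⊵ inj₂ z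
Λ⁻¹ℰ-⊵-secondary (k , p , q) (l , r) (n , s , t) x⊵z′ =
  by x⊵z′ (slack k n (δ q r) (δ r s) (δ s t))
  where
  slack : ∀ k n b c d → (k - ((n + d) + c)) - b ≡ (k - b) - (n + d) - c
  slack = solve-∀

Λ⁻¹ℰ-⊵-primary : ∀ (x : ℰ m) (y : 𝒪 m) z →
  inj₂ x ⊵ inj₁ y → inj₁ y ⊵ inj₁ z → inj₂ (Λ⁻¹ℰ x y) ⊵ inj₁ z
Λ⁻¹ℰ-⊵-primary (k , p , q) (l , r) (n , s) x⊵y y⊵z =
  by (x⊵y ⊕ y⊵z ⊕ δ≤1 q r) (slack k l n (δ p q) (δ q r) (δ r s))
  where
  slack : ∀ k l n a b c →
    (((+ 2 * k + a) - l) + ((l - n) + 1ℤ)) - ((1ℤ + a + b) + ((1ℤ + c) + b)) ≡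
    (+ 2 * (k - b) + b) - n - (1ℤ + b + c)
  slack = solve-∀

-- Runs of the two rules

-- What is needed of a rule to conclude that its runs stay among the balanced
-- sequences and can be read backwards as runs of another rule.
record Reversible {m} (Rule Rule′ : Rel (Part m × Part m) 0ℓ) : Set where
  field
    balanced : ∀ {x y x′ y′ zs} → Rule (x , y) (x′ , y′) →
               Balanced (x ∷ y ∷ zs) → Balanced (x′ ∷ y′ ∷ zs)
    fronts   : ∀ {x y x′ y′ zs} → Rule (x , y) (x′ , y′) →
               Front (x′ ∷ y′ ∷ zs) ⊆ Front (x ∷ y ∷ zs)
    reverse  : ∀ {x y x′ y′ zs} → Rule (x , y) (x′ , y′) →
               Balanced (x ∷ y ∷ zs) → Rule′ (x′ , y′) (x , y)

  step-fronts : ∀ {xs ys} → Step Rule xs ys → Front ys ⊆ Front xs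
  step-fronts (here r)  z∈              = fronts r z∈
  step-fronts (there s) here            = here
  step-fronts (there s) (later z∈ pull) = later (step-fronts s z∈) pull

  step : ∀ {xs ys} → Step Rule xs ys → Balanced xs → Balanced ys × Step Rule′ ys xs
  step (here r) bal = balanced r bal , here (reverse r bal)
  step (there s) (0<x ∷ ps , f ∷ ds) with step s (ps , ds)
  ... | (ps′ , ds′) , s′ =
    (0<x ∷ ps′ , (λ z∈ → f (step-fronts s z∈)) ∷ ds′) , there s′

  run : ∀ {xs ys} → Star (Step Rule) xs ys → Balanced xs →
        Balanced ys × Star (Step Rule′) ys xs
  run ε        bal = bal , ε
  run (s ◅ ss) bal with step s bal
  ... | bal′ , s′ with run ss bal′
  ... | bal″ , ss′ = bal″ , ss′ ◅◅ (s′ ◅ ε)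

Φ-reversible : Reversible (Φ-Rule {m}) Ψ-Rule
Φ-reversible {m} = record { balanced = balanced ; fronts = fronts ; reverse = reverse }
  where
  balanced : ∀ {x y x′ y′ zs} → Φ-Rule {m} (x , y) (x′ , y′) →
             Balanced (x ∷ y ∷ zs) → Balanced (x′ ∷ y′ ∷ zs)
  balanced {zs = zs} (cross {x} {y} x≫̸y) (_ ∷ 0<y ∷ ps , f ∷ g ∷ ds)
    with Λ-positive x y 0<y (f here)
  ... | 0<x′ , 0<y′ = 0<x′ ∷ 0<y′ ∷ ps , f′ ∷ g′ ∷ ds
    where
    f′ : Front (inj₁ (Λ𝒪 x y) ∷ zs) ⊆ (inj₂ (Λℰ x y) ⊵_)
    f′ here                          = Λ-≫ x y x≫̸y
    f′ (later {z = inj₂ z} z∈ over𝒪) = Λℰ-⊵ x y z (g z∈)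
    g′ : Front zs ⊆ (inj₁ (Λ𝒪 x y) ⊵_)
    g′ {inj₁ z} z∈ = Λ𝒪-⊵-primary x y z (f (later z∈ overℰ))
    g′ {inj₂ z} z∈ = Λ𝒪-⊵-secondary x y z (f here) (g z∈)

  fronts : ∀ {x y x′ y′ zs} → Φ-Rule {m} (x , y) (x′ , y′) →
           Front (x′ ∷ y′ ∷ zs) ⊆ Front (x ∷ y ∷ zs)
  fronts (cross _) here = later here over𝒪
  fronts (cross {x} {y} _) (later here overℰ) =
    subst (Front _) (cong (λ xy → inj₁ (proj₁ xy)) (sym (Λ⁻¹∘Λ x y))) here
  fronts (cross _) (later (later z∈ over𝒪) ())

  reverse : ∀ {x y x′ y′ zs} → Φ-Rule {m} (x , y) (x′ , y′) →
            Balanced (x ∷ y ∷ zs) → Ψ-Rule (x′ , y′) (x , y)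
  reverse (cross {x} {y} _) (_ , f ∷ _) =
    subst (λ xy → Ψ-Rule (map inj₂ inj₁ (Λ (x , y))) (map inj₁ inj₂ xy)) (Λ⁻¹∘Λ x y)
      (cross {x = Λℰ x y} {y = Λ𝒪 x y} (Λ-≯ x y (f here)))

Ψ-reversible : Reversible (Ψ-Rule {m}) Φ-Rule
Ψ-reversible {m} = record { balanced = balanced ; fronts = fronts ; reverse = reverse }
  where
  balanced : ∀ {x y x′ y′ zs} → Ψ-Rule {m} (x , y) (x′ , y′) →
             Balanced (x ∷ y ∷ zs) → Balanced (x′ ∷ y′ ∷ zs)
  balanced {zs = zs} (cross {x} {y} x≯y) (_ ∷ 0<y ∷ ps , f ∷ g ∷ ds)
    with Λ⁻¹-positive x y 0<y (f here)
  ... | 0<x′ , 0<y′ = 0<x′ ∷ 0<y′ ∷ ps , f′ ∷ g′ ∷ ds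
    where
    f′ : Front (inj₂ (Λ⁻¹ℰ x y) ∷ zs) ⊆ (inj₁ (Λ⁻¹𝒪 x y) ⊵_)
    f′ here                          = Λ⁻¹-⊳ x y x≯y
    f′ (later {z = inj₁ z} z∈ overℰ) = Λ⁻¹𝒪-⊵ x y z (g z∈)
    g′ : Front zs ⊆ (inj₂ (Λ⁻¹ℰ x y) ⊵_)
    g′ {inj₁ z} z∈ = Λ⁻¹ℰ-⊵-primary x y z (f here) (g z∈)
    g′ {inj₂ z} z∈ = Λ⁻¹ℰ-⊵-secondary x y z (f (later z∈ over𝒪))

  fronts : ∀ {x y x′ y′ zs} → Ψ-Rule {m} (x , y) (x′ , y′) →
           Front (x′ ∷ y′ ∷ zs) ⊆ Front (x ∷ y ∷ zs)
  fronts (cross _) here = later here overℰ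
  fronts (cross {x} {y} _) (later here over𝒪) =
    subst (Front _) (cong (λ xy → inj₂ (proj₁ xy)) (sym (Λ∘Λ⁻¹ x y))) here
  fronts (cross _) (later (later z∈ overℰ) ())

  reverse : ∀ {x y x′ y′ zs} → Ψ-Rule {m} (x , y) (x′ , y′) →
            Balanced (x ∷ y ∷ zs) → Φ-Rule (x′ , y′) (x , y)
  reverse (cross {x} {y} _) (_ , f ∷ _) =
    subst (λ xy → Φ-Rule (map inj₁ inj₂ (Λ⁻¹ (x , y))) (map inj₂ inj₁ xy)) (Λ∘Λ⁻¹ x y)
      (cross {x = Λ⁻¹𝒪 x y} {y = Λ⁻¹ℰ x y} (Λ⁻¹-≫̸ x y (f here)))

linked-normal : ∀ {A : Set} {R : Rel A 0ℓ} {Rule : Rel (A × A) 0ℓ} →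
                (∀ {x y u} → R x y → ¬ Rule (x , y) u) →
                ∀ {xs} → Linked R xs → IsNormalForm (Step Rule) xs
linked-normal disjoint (xRy ∷ _)    (_ , here r)  = disjoint xRy r
linked-normal disjoint (_ ∷ linked) (_ , there s) = linked-normal disjoint linked (-, s)
linked-normal disjoint [-]          (_ , there ())
linked-normal disjoint []           (_ , ())

normal-linked : ∀ {A : Set} {R S : Rel A 0ℓ} {Rule : Rel (A × A) 0ℓ} →
                (∀ x y → R x y → (∀ {u} → ¬ Rule (x , y) u) → S x y) →
                ∀ {xs} → IsNormalForm (Step Rule) xs → Linked R xs → Linked S xs
normal-linked strengthen n []  = []
normal-linked strengthen n [-] = [-]
normal-linked strengthen n (xRy ∷ linked) =
  strengthen _ _ xRy (λ r → n (-, here r)) ∷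
  normal-linked strengthen (λ (_ , s) → n (-, there s)) linked

ℳ⇒normal : ∀ {xs : List (Part m)} → xs ∈ℳ → Ψ₁.Normal xs
ℳ⇒normal (_ , linked) = linked-normal (λ { x⊳y (cross x≯y) → x≯y x⊳y }) linked

𝒟⇒normal : ∀ {xs : List (Part m)} → xs ∈𝒟 → Φ₂.Normal xs
𝒟⇒normal (_ , linked) = linked-normal (λ { x≫y (cross x≫̸y) → x≫̸y x≫y }) linked

balanced-normal⇒ℳ : ∀ {xs : List (Part m)} → Balanced xs → Ψ₁.Normal xs → xs ∈ℳ
balanced-normal⇒ℳ (ps , ds) n =
  ps , normal-linked strengthen n (dominating⇒linked ds)
  where
  strengthen : ∀ (x y : Part m) → x ⊵ y → (∀ {u} → ¬ Ψ-Rule (x , y) u) → x ⊳ y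
  strengthen (inj₁ x) y        x⊵y _ = x⊵y
  strengthen (inj₂ x) (inj₂ y) x⊵y _ = x⊵y
  strengthen (inj₂ x) (inj₁ y) x⊵y ¬r with μ x >ᶜ? y
  ... | yes x>y = x>y
  ... | no  x≯y = contradiction (cross x≯y) ¬r

balanced-normal⇒𝒟 : ∀ {xs : List (Part m)} → Balanced xs → Φ₂.Normal xs → xs ∈𝒟
balanced-normal⇒𝒟 (ps , ds) n =
  ps , normal-linked strengthen n (dominating⇒linked ds)
  where
  strengthen : ∀ (x y : Part m) → x ⊵ y → (∀ {u} → ¬ Φ-Rule (x , y) u) → x ≫ y
  strengthen (inj₁ x) (inj₁ y) x⊵y _ = x⊵y
  strengthen (inj₂ x) (inj₁ y) x⊵y _ = x⊵y
  strengthen (inj₂ x) (inj₂ y) x⊵y _ = ⊳⇒≫-secondary x y x⊵y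
  strengthen (inj₁ x) (inj₂ y) x⊵y ¬r with inj₁ x ≫? inj₂ y
  ... | yes x≫y = x≫y
  ... | no  x≫̸y = contradiction (cross x≫̸y) ¬r

-- Merging and splitting

≫⇒>ᶜ : ∀ (x y : 𝒪 m) → inj₁ x ≫ inj₁ y → x >ᶜ y
≫⇒>ᶜ (k , p) (l , q) x≫y = by (x≫y ⊕ 0≤1) (slack k l (δ p q))
  where
  slack : ∀ k l a → (k - l + 1ℤ) - (1ℤ + a + 0ℤ) ≡ k - l - a
  slack = solve-∀

γ>ᶜμ : ∀ (z : ℰ m) → γ z >ᶜ μ z
γ>ᶜμ (k , p , q) = by (≤-refl {0ℤ}) (slack k (δ p q))
  where
  slack : ∀ k a → 0ℤ - 0ℤ ≡ (k + a) - k - a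
  slack = solve-∀

γ≫̸μ : ∀ (z : ℰ m) → ¬ inj₁ (γ z) ≫ inj₁ (μ z)
γ≫̸μ (k , p , q) γ≫μ = absurd γ≫μ (slack k (δ p q))
  where
  slack : ∀ k a → (k + a) - k - (1ℤ + a) ≡ -1ℤ
  slack = solve-∀

Φ₁-positive : ∀ {xs : List (𝒪 m)} → All (λ x → Positive (inj₁ x)) xs → All Positive (Φ₁ xs)
Φ₁-positive []         = []
Φ₁-positive (0<x ∷ []) = 0<x ∷ []
Φ₁-positive {xs = x ∷ y ∷ zs} (0<x ∷ 0<y ∷ ps)
  with inj₁ x ≫? inj₁ y | Φ₁-positive (0<y ∷ ps)
... | yes _ | rest = 0<x ∷ rest
... | no  _ | _    = 0<y ∷ Φ₁-positive ps

-- The head of Φ₁ (x ∷ xs) is x or a secondary part with upper half x.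
Φ₁-head : ∀ a (x : 𝒪 m) {xs} → Linked _>ᶜ_ (x ∷ xs) → a ⊳ inj₁ x →
          Connected _⊳_ (just a) (head (Φ₁ (x ∷ xs)))
Φ₁-head a x [-] a⊳x = just a⊳x
Φ₁-head a x (_∷_ {y = y} x>y _) a⊳x with inj₁ x ≫? inj₁ y
... | yes _   = just a⊳x
... | no x≫̸y = just (⊳-upper a (sym (proj₁ (merge-halves x y x>y x≫̸y))) a⊳x)
  where
  ⊳-upper : ∀ a {x} {z : ℰ m} → x ≡ γ z → a ⊳ inj₁ x → a ⊳ inj₂ z
  ⊳-upper (inj₁ _) refl a⊳x = a⊳x
  ⊳-upper (inj₂ _) refl a⊳x = a⊳x

Φ₁-linked : ∀ {xs : List (𝒪 m)} → Linked _>ᶜ_ xs → Linked _⊳_ (Φ₁ xs)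
Φ₁-linked []  = []
Φ₁-linked [-] = [-]
Φ₁-linked (_∷_ {x} {y} x>y linked) with inj₁ x ≫? inj₁ y
... | yes x≫y = Φ₁-head (inj₁ x) y linked x≫y ∷′ Φ₁-linked linked
Φ₁-linked (_∷_ {x} {y} x>y [-]) | no _ = [-]
Φ₁-linked (_∷_ {x} {y} x>y (_∷_ {y = z} y>z linked)) | no _ =
  Φ₁-head (inj₂ (merge x y)) z linked y>z ∷′ Φ₁-linked linked

Φ₁-∈ℳ : ∀ {xs : List (𝒪 m)} → xs ∈𝒞 → Φ₁ xs ∈ℳ
Φ₁-∈ℳ (ps , linked) = Φ₁-positive ps , Φ₁-linked linked

Ψ₂-positive : ∀ {xs : List (Part m)} → All Positive xs → All (λ x → Positive (inj₁ x)) (Ψ₂ xs)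
Ψ₂-positive []                        = []
Ψ₂-positive {xs = inj₁ _ ∷ _} (p ∷ ps) = p ∷ Ψ₂-positive ps
Ψ₂-positive {xs = inj₂ _ ∷ _} (p ∷ ps) = positive+δ _ _ p ∷ p ∷ Ψ₂-positive ps

Ψ₂-linked : ∀ {xs : List (Part m)} → Linked _⊳_ xs → Linked _>ᶜ_ (Ψ₂ xs)
Ψ₂-linked [] = []
Ψ₂-linked ([-] {inj₁ _}) = [-]
Ψ₂-linked ([-] {inj₂ z}) = γ>ᶜμ z ∷ [-]
Ψ₂-linked (_∷_ {inj₁ x} {inj₁ y} r linked) = ≫⇒>ᶜ x y r ∷ Ψ₂-linked linked
Ψ₂-linked (_∷_ {inj₁ x} {inj₂ y} r linked) = ≫⇒>ᶜ x (γ y) r ∷ Ψ₂-linked linked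
Ψ₂-linked (_∷_ {inj₂ x} {inj₁ _} r linked) = γ>ᶜμ x ∷ r ∷ Ψ₂-linked linked
Ψ₂-linked (_∷_ {inj₂ x} {inj₂ _} r linked) = γ>ᶜμ x ∷ r ∷ Ψ₂-linked linked

Ψ₂-∈𝒞 : ∀ {xs : List (Part m)} → xs ∈ℳ → Ψ₂ xs ∈𝒞
Ψ₂-∈𝒞 (ps , linked) = Ψ₂-positive ps , Ψ₂-linked linked

Ψ₂∘Φ₁ : ∀ {xs : List (𝒪 m)} → Linked _>ᶜ_ xs → Ψ₂ (Φ₁ xs) ≡ xs
Ψ₂∘Φ₁ []  = refl
Ψ₂∘Φ₁ [-] = refl
Ψ₂∘Φ₁ (_∷_ {x} {y} x>y linked) with inj₁ x ≫? inj₁ y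
... | yes _ = cong (x ∷_) (Ψ₂∘Φ₁ linked)
Ψ₂∘Φ₁ (_∷_ {x} {y} x>y [-]) | no x≫̸y =
  cong (_∷ y ∷ []) (proj₁ (merge-halves x y x>y x≫̸y))
Ψ₂∘Φ₁ (_∷_ {x} {y} x>y (_ ∷ linked)) | no x≫̸y =
  cong₂ (λ x′ zs → x′ ∷ y ∷ zs) (proj₁ (merge-halves x y x>y x≫̸y)) (Ψ₂∘Φ₁ linked)

Φ₁-separate : ∀ (x y : 𝒪 m) zs → inj₁ x ≫ inj₁ y →
              Φ₁ (x ∷ y ∷ zs) ≡ inj₁ x ∷ Φ₁ (y ∷ zs)
Φ₁-separate x y zs x≫y with inj₁ x ≫? inj₁ y
... | yes _   = refl
... | no x≫̸y = contradiction x≫y x≫̸y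

Φ₁-merge : ∀ (z : ℰ m) zs → Φ₁ (γ z ∷ μ z ∷ zs) ≡ inj₂ z ∷ Φ₁ zs
Φ₁-merge z zs with inj₁ (γ z) ≫? inj₁ (μ z)
... | yes γ≫μ = contradiction γ≫μ (γ≫̸μ z)
... | no _    = refl

Φ₁∘Ψ₂ : ∀ {xs : List (Part m)} → Linked _⊳_ xs → Φ₁ (Ψ₂ xs) ≡ xs
Φ₁∘Ψ₂ [] = refl
Φ₁∘Ψ₂ ([-] {inj₁ _}) = refl
Φ₁∘Ψ₂ ([-] {inj₂ z}) = Φ₁-merge z []
Φ₁∘Ψ₂ (_∷_ {inj₁ x} {inj₁ y} {zs} x⊳y linked) =
  trans (Φ₁-separate x y (Ψ₂ zs) x⊳y) (cong (inj₁ x ∷_) (Φ₁∘Ψ₂ linked))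
Φ₁∘Ψ₂ (_∷_ {inj₁ x} {inj₂ y} {zs} x⊳y linked) =
  trans (Φ₁-separate x (γ y) (μ y ∷ Ψ₂ zs) x⊳y) (cong (inj₁ x ∷_) (Φ₁∘Ψ₂ linked))
Φ₁∘Ψ₂ (_∷_ {inj₂ x} {y} {zs} _ linked) =
  trans (Φ₁-merge x (Ψ₂ (y ∷ zs))) (cong (inj₂ x ∷_) (Φ₁∘Ψ₂ linked))

-- The two maps are mutually inverse

-- The value of Φ at a member of 𝒞 is in 𝒟, and the first step of Ψ leads from
-- it back to the sequence obtained by merging.
Φ-outcome : ∀ {xs : List (𝒪 m)} → xs ∈𝒞 →
            Φ xs ∈𝒟 × Ψ₁.normalise (Φ xs) ≡ Φ₁ xs
Φ-outcome {xs = xs} xs∈𝒞 with Φ₁-∈ℳ xs∈𝒞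
... | merged∈ℳ
  with Reversible.run Φ-reversible (Φ₂.normalise-run (Φ₁ xs)) (ℳ⇒balanced merged∈ℳ)
... | bal , back =
  balanced-normal⇒𝒟 bal (Φ₂.normalise-normal (Φ₁ xs)) ,
  Ψ₁.normalise-outcome (back , ℳ⇒normal merged∈ℳ)

-- The first step of Ψ leads from a member of 𝒟 to ℳ, and the second step of Φ
-- leads back.
Ψ₁-outcome : ∀ {ys : List (Part m)} → ys ∈𝒟 →
             Ψ₁.normalise ys ∈ℳ × Φ₂.normalise (Ψ₁.normalise ys) ≡ ys
Ψ₁-outcome {ys = ys} ys∈𝒟
  with Reversible.run Ψ-reversible (Ψ₁.normalise-run ys) (𝒟⇒balanced ys∈𝒟)
... | bal , back =
  balanced-normal⇒ℳ bal (Ψ₁.normalise-normal ys) ,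
  Φ₂.normalise-outcome (back , 𝒟⇒normal ys∈𝒟)

mainTheorem4 : (m : ℕ) →
    ((xs : List (𝒪 m)) → xs ∈𝒞 → Φ xs ∈𝒟) ×
    ((ys : List (Part m)) → ys ∈𝒟 → Ψ ys ∈𝒞) ×
    ((xs : List (𝒪 m)) → xs ∈𝒞 → Ψ (Φ xs) ≡ xs) ×
    ((ys : List (Part m)) → ys ∈𝒟 → Φ (Ψ ys) ≡ ys)
mainTheorem4 m =
  (λ _ xs∈𝒞 → proj₁ (Φ-outcome xs∈𝒞)) ,
  (λ _ ys∈𝒟 → Ψ₂-∈𝒞 (proj₁ (Ψ₁-outcome ys∈𝒟))) ,
  (λ _ xs∈𝒞 → trans (cong Ψ₂ (proj₂ (Φ-outcome xs∈𝒞))) (Ψ₂∘Φ₁ (proj₂ xs∈𝒞))) ,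
  (λ _ ys∈𝒟 → let split∈ℳ , Φ₂-back = Ψ₁-outcome ys∈𝒟 in
    trans (cong Φ₂.normalise (Φ₁∘Ψ₂ (proj₂ split∈ℳ))) Φ₂-back)
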